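{- Let $O_n$ be the ortho-chain square cactus of length $n$, let $O_n+e$ be the graph obtained from $O_n$ by attaching a pendant vertex to its end vertex $c_n$, and let $O_n(2)$ be the graph obtained from $O_n$ by attaching a pendant path with two new vertices at $c_n$. For every $n\ge 2$, $$D(O_n,x)=x\,D(O_{n-1},x)+(x^2+2x)\,D(O_{n-1}+e,x)+x^2\,D(O_{n-2}(2),x),$$ with initial condition $D(O_1,x)=x^4+4x^3+6x^2$.
   Context: For a finite simple graph $G=(V,E)$, a set $S\subseteq V$ is dominating if every vertex of $V\setminus S$ is adjacent to at least one vertex of $S$. Let $d(G,i)$ be the number of dominating sets of $G$ of cardinality $i$. The domination polynomial of $G$ is $D(G,x)=\sum_{i=\gamma(G)}^{|V|} d(G,i)x^i$, where $\gamma(G)$ is the minimum cardinality of a dominating set. The ortho-chain $O_n$ is the chain of $n$ squares ($4$-cycles), consecutive squares sharing a cut-vertex, in which the two cut-vertices of each internal square are adjacent. Concretely, $O_n$ has vertices $c_0,\dots,c_n,a_1,\dots,a_n,b_1,\dots,b_n$ and edges $c_{i-1}c_i,\ c_ib_i,\ b_ia_i,\ a_ic_{i-1}$ for $1\le i\le n$; $O_0$ is the single vertex $c_0$. The graph $O_n+e$ is obtained from $O_n$ by adding a new vertex $p$ and the edge $c_np$. The graph $O_n(2)$ is obtained from $O_n$ by adding two new vertices $p,q$ and the edges $c_np$ and $pq$ (so $O_0(2)$ is the path on three vertices). -}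

module Defs where

open import Data.Empty using (⊥)
open import Data.Nat.Base as ℕ using (ℕ; zero; suc; _∸_; _≤_)
import Data.Nat.Properties as ℕ
open import Data.Fin.Base using (Fin; zero; suc; inject₁; fromℕ; toℕ)
open import Data.Fin.Properties as Fin using (any?; all?; toℕ-inject₁)
open import Data.Fin.Subset using (Subset; inside; outside; _∈_; _∉_; ∣_∣; ⊤)
open import Data.Fin.Subset.Properties using (_∈?_; ∈⊤)
open import Data.List.Base using (List; []; _∷_; _++_; map; filter; length; foldr; applyUpTo)
open import Data.List.Extrema.Nat using (argmin; argmin-all; f[argmin]≤f[xs])
open import Data.List.Membership.Propositional using () renaming (_∈_ to _∈ˡ_)
open import Data.List.Membership.Propositional.Properties using (∈-++⁺ˡ; ∈-++⁺ʳ; ∈-map⁺; ∈-map⁻; ∈-filter⁺)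
open import Data.List.Relation.Unary.All as All using ([])
open import Data.List.Relation.Unary.All.Properties using (all-filter)
open import Data.List.Relation.Unary.AllPairs using ([]; _∷_)
open import Data.List.Relation.Unary.Any using (here)
open import Data.List.Relation.Unary.Unique.Propositional using (Unique)
import Data.List.Relation.Unary.Unique.Propositional.Properties as Unique
open import Data.Maybe.Base using (Maybe; just; nothing)
open import Data.Product.Base using (_×_; _,_; ∃)
open import Data.Sum.Base using (inj₁; inj₂; [_,_])
open import Data.Vec.Base using ([]; _∷_)
open import Data.Vec.Properties using (∷-injectiveʳ)
open import Function.Bundles using (_↔_; mk↔ₛ′; module Inverse)
open import Level using (0ℓ)
open import Relation.Binary.Construct.Closure.Symmetric using (SymClosure; fwd; bwd; symmetric)
open import Relation.Binary.Core using (Rel)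
open import Relation.Binary.Definitions using (Symmetric; Irreflexive; Decidable)
open import Relation.Binary.PropositionalEquality using (_≡_; _≢_; refl; sym; trans; cong; subst)
open import Relation.Nullary.Decidable using (Dec; yes; no; map′; ¬?; _×-dec_; _⊎-dec_; _→-dec_)
open import Relation.Nullary.Negation using (contradiction)

------------------------------------------------------------------------
-- Univariate polynomials

-- Coefficient lists, constant term first.  Domination polynomials have
-- coefficients in ℕ and no subtraction is needed, so we work in ℕ[x],
-- on which equality agrees with that of ℤ[x].
Poly : Set
Poly = List ℕ

coeff : Poly → ℕ → ℕ
coeff []      _       = 0
coeff (a ∷ p) zero    = a
coeff (a ∷ p) (suc k) = coeff p k

infix  4 _≈ₚ_
infixl 6 _+ₚ_
infixl 7 _*ₚ_
infixr 8 _^ₚ_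

-- Lists that differ only by trailing zeros are the same polynomial.
_≈ₚ_ : Rel Poly 0ℓ
p ≈ₚ q = ∀ k → coeff p k ≡ coeff q k

const : ℕ → Poly
const a = a ∷ []

X : Poly
X = 0 ∷ 1 ∷ []

_+ₚ_ : Poly → Poly → Poly
[]      +ₚ q       = q
(a ∷ p) +ₚ []      = a ∷ p
(a ∷ p) +ₚ (b ∷ q) = a ℕ.+ b ∷ p +ₚ q

_*ₚ_ : Poly → Poly → Poly
[]      *ₚ q = []
(a ∷ p) *ₚ q = map (a ℕ.*_) q +ₚ (0 ∷ p *ₚ q)

_^ₚ_ : Poly → ℕ → Poly
p ^ₚ zero  = const 1
p ^ₚ suc k = p *ₚ p ^ₚ k

sumₚ : List Poly → Poly
sumₚ = foldr _+ₚ_ []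

------------------------------------------------------------------------
-- Finite simple graphs

record Graph : Set₁ where
  field
    Vertex     : Set
    order      : ℕ
    enumerate  : Vertex ↔ Fin order
    Adj        : Rel Vertex 0ℓ
    Adj-sym    : Symmetric Adj
    Adj-irrefl : Irreflexive _≡_ Adj
    Adj?       : Decidable Adj

  open Inverse enumerate public
    using () renaming (to to index; from to vertex;
                       strictlyInverseˡ to index-vertex;
                       strictlyInverseʳ to vertex-index)

------------------------------------------------------------------------
-- Domination

subsets : ∀ n → List (Subset n)
subsets zero    = [] ∷ []
subsets (suc n) = map (outside ∷_) (subsets n) ++ map (inside ∷_) (subsets n)

subsets-complete : ∀ {n} (S : Subset n) → S ∈ˡ subsets n
subsets-complete []            = here refl
subsets-complete (outside ∷ S) = ∈-++⁺ˡ (∈-map⁺ _ (subsets-complete S))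
subsets-complete (inside  ∷ S) = ∈-++⁺ʳ _ (∈-map⁺ _ (subsets-complete S))

subsets-unique : ∀ n → Unique (subsets n)
subsets-unique zero    = [] ∷ []
subsets-unique (suc n) =
  Unique.++⁺ (Unique.map⁺ ∷-injectiveʳ (subsets-unique n))
             (Unique.map⁺ ∷-injectiveʳ (subsets-unique n))
             λ (S∈out , S∈in) → disjoint (∈-map⁻ _ S∈out) (∈-map⁻ _ S∈in)
  where
  disjoint : ∀ {S : Subset (suc n)} →
             ∃ (λ T → T ∈ˡ subsets n × S ≡ outside ∷ T) →
             ∃ (λ T → T ∈ˡ subsets n × S ≡ inside ∷ T) → ⊥
  disjoint (_ , _ , refl) (_ , _ , ())

module _ (G : Graph) where
  open Graph G

  Dominating : Subset order → Set
  Dominating S = ∀ v → index v ∉ S → ∃ λ u → index u ∈ S × Adj u v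

  Dominating? : ∀ S → Dec (Dominating S)
  Dominating? S =
    map′ (λ dom v → subst DominatedOutside (vertex-index v) (dom (index v)))
         (λ dom i → dom (vertex i))
         (all? λ i → ¬? (index (vertex i) ∈? S) →-dec neighbour? (vertex i))
    where
    DominatedOutside : Vertex → Set
    DominatedOutside v = index v ∉ S → ∃ λ u → index u ∈ S × Adj u v

    neighbour? : ∀ v → Dec (∃ λ u → index u ∈ S × Adj u v)
    neighbour? v =
      map′ (λ (i , p) → vertex i , p)
           (λ (u , p) → index u ,
              subst (λ w → index w ∈ S × Adj w v) (sym (vertex-index u)) p)
           (any? λ i → (index (vertex i) ∈? S) ×-dec Adj? (vertex i) v)

  dominatingSets : List (Subset order)
  dominatingSets = filter Dominating? (subsets order)

  d : ℕ → ℕ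
  d i = length (filter (λ S → ∣ S ∣ ℕ.≟ i) dominatingSets)

  minimumDominatingSet : Subset order
  minimumDominatingSet = argmin ∣_∣ ⊤ dominatingSets

  γ : ℕ
  γ = ∣ minimumDominatingSet ∣

  minimumDominatingSet-dominating : Dominating minimumDominatingSet
  minimumDominatingSet-dominating =
    argmin-all ∣_∣ (λ v v∉⊤ → contradiction ∈⊤ v∉⊤)
                   (all-filter Dominating? (subsets order))

  γ-minimal : ∀ S → Dominating S → γ ≤ ∣ S ∣
  γ-minimal S dom =
    All.lookup (f[argmin]≤f[xs] ⊤ dominatingSets)
               (∈-filter⁺ Dominating? (subsets-complete S) dom)

  -- The exponents are γ, γ + 1, …, order.
  D : Poly
  D = sumₚ (map (λ i → const (d i) *ₚ X ^ₚ i)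
                (applyUpTo (γ ℕ.+_) (suc order ∸ γ)))

------------------------------------------------------------------------
-- Attaching a pendant vertex

data PendantEdge {V : Set} (E : Rel V 0ℓ) (w : V) : Rel (Maybe V) 0ℓ where
  old : ∀ {u v} → E u v → PendantEdge E w (just u) (just v)
  new : PendantEdge E w (just w) nothing

-- The new vertex is nothing, joined to w only.
pendant : (G : Graph) → Graph.Vertex G → Graph
pendant G w = record
  { Vertex     = Maybe Vertex
  ; order      = suc order
  ; enumerate  = mk↔ₛ′ to from to-from from-to
  ; Adj        = SymClosure (PendantEdge Adj w)
  ; Adj-sym    = symmetric _
  ; Adj-irrefl = λ { refl (fwd (old e)) → Adj-irrefl refl e
                   ; refl (bwd (old e)) → Adj-irrefl refl e }
  ; Adj?       = λ u v → map′ [ fwd , bwd ]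
                   (λ { (fwd e) → inj₁ e ; (bwd e) → inj₂ e })
                   (edge? u v ⊎-dec edge? v u)
  }
  where
  open Graph G

  to : Maybe Vertex → Fin (suc order)
  to nothing  = zero
  to (just v) = suc (index v)

  from : Fin (suc order) → Maybe Vertex
  from zero    = nothing
  from (suc i) = just (vertex i)

  to-from : ∀ i → to (from i) ≡ i
  to-from zero    = refl
  to-from (suc i) = cong suc (index-vertex i)

  from-to : ∀ v → from (to v) ≡ v
  from-to nothing  = refl
  from-to (just v) = cong just (vertex-index v)

  _≟_ : Decidable {A = Vertex} _≡_
  u ≟ v = map′ (λ eq → trans (sym (vertex-index u)) (trans (cong vertex eq) (vertex-index v)))
               (cong index) (index u Fin.≟ index v)

  edge? : Decidable (PendantEdge Adj w)
  edge? (just u) (just v) = map′ old (λ { (old e) → e }) (Adj? u v)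
  edge? (just u) nothing  = map′ (λ { refl → new }) (λ { new → refl }) (u ≟ w)
  edge? nothing  _        = no λ ()

------------------------------------------------------------------------
-- Ortho-chains

-- With i : Fin n counting from 0, the vertices a i and b i are
-- a_{i+1} and b_{i+1}, and the square containing them has
-- cut-vertices c (inject₁ i) = c_i and c (suc i) = c_{i+1}.
data ChainVertex (n : ℕ) : Set where
  c : Fin (suc n) → ChainVertex n
  a : Fin n → ChainVertex n
  b : Fin n → ChainVertex n

data ChainEdge {n : ℕ} : Rel (ChainVertex n) 0ℓ where
  cc : ∀ i → ChainEdge (c (inject₁ i)) (c (suc i))
  cb : ∀ i → ChainEdge (c (suc i))     (b i)
  ba : ∀ i → ChainEdge (b i)           (a i)
  ac : ∀ i → ChainEdge (a i)           (c (inject₁ i))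

chainOrder : ℕ → ℕ
chainOrder zero    = 1
chainOrder (suc n) = 3 ℕ.+ chainOrder n

chainShift : ∀ {n} → ChainVertex n → ChainVertex (suc n)
chainShift (c i) = c (suc i)
chainShift (a i) = a (suc i)
chainShift (b i) = b (suc i)

-- The vertices are listed as c₀, a₁, b₁, c₁, a₂, b₂, …, cₙ.
chainIndex : ∀ {n} → ChainVertex n → Fin (chainOrder n)
chainIndex {zero}  (c zero)    = zero
chainIndex {suc n} (c zero)    = zero
chainIndex {suc n} (a zero)    = suc zero
chainIndex {suc n} (b zero)    = suc (suc zero)
chainIndex {suc n} (c (suc i)) = suc (suc (suc (chainIndex (c i))))
chainIndex {suc n} (a (suc i)) = suc (suc (suc (chainIndex (a i))))
chainIndex {suc n} (b (suc i)) = suc (suc (suc (chainIndex (b i))))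

chainVertex : ∀ {n} → Fin (chainOrder n) → ChainVertex n
chainVertex {zero}  zero                = c zero
chainVertex {suc n} zero                = c zero
chainVertex {suc n} (suc zero)          = a zero
chainVertex {suc n} (suc (suc zero))    = b zero
chainVertex {suc n} (suc (suc (suc i))) = chainShift (chainVertex i)

chainIndex-shift : ∀ {n} (v : ChainVertex n) →
                   chainIndex (chainShift v) ≡ suc (suc (suc (chainIndex v)))
chainIndex-shift (c i) = refl
chainIndex-shift (a i) = refl
chainIndex-shift (b i) = refl

chainIndex-vertex : ∀ {n} (i : Fin (chainOrder n)) → chainIndex (chainVertex {n} i) ≡ i
chainIndex-vertex {zero}  zero                = refl
chainIndex-vertex {suc n} zero                = refl
chainIndex-vertex {suc n} (suc zero)          = refl
chainIndex-vertex {suc n} (suc (suc zero))    = refl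
chainIndex-vertex {suc n} (suc (suc (suc i))) =
  trans (chainIndex-shift (chainVertex {n} i))
        (cong (λ j → suc (suc (suc j))) (chainIndex-vertex {n} i))

chainVertex-index : ∀ {n} (v : ChainVertex n) → chainVertex (chainIndex v) ≡ v
chainVertex-index {zero}  (c zero)    = refl
chainVertex-index {suc n} (c zero)    = refl
chainVertex-index {suc n} (a zero)    = refl
chainVertex-index {suc n} (b zero)    = refl
chainVertex-index {suc n} (c (suc i)) = cong chainShift (chainVertex-index (c i))
chainVertex-index {suc n} (a (suc i)) = cong chainShift (chainVertex-index (a i))
chainVertex-index {suc n} (b (suc i)) = cong chainShift (chainVertex-index (b i))

ChainEdge-irrefl : ∀ {n} {u v : ChainVertex n} → ChainEdge u v → u ≢ v
ChainEdge-irrefl (cb _) ()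
ChainEdge-irrefl (ba _) ()
ChainEdge-irrefl (ac _) ()
ChainEdge-irrefl (cc i) eq = inject₁≢suc (c-injective eq)
  where
  c-injective : ∀ {n} {i j : Fin (suc n)} → c {n} i ≡ c j → i ≡ j
  c-injective refl = refl

  inject₁≢suc : ∀ {n} {i : Fin n} → inject₁ i ≢ suc i
  inject₁≢suc {i = i} eq =
    ℕ.1+n≢n (trans (sym (cong toℕ eq)) (toℕ-inject₁ i))

ChainEdge? : ∀ {n} → Decidable (ChainEdge {n})
ChainEdge? (c _) (c zero)    = no λ ()
ChainEdge? (c i) (c (suc j)) = map′ (λ { refl → cc j }) (λ { (cc _) → refl }) (i Fin.≟ inject₁ j)
ChainEdge? (c _) (a _)       = no λ ()
ChainEdge? (c i) (b j)       = map′ (λ { refl → cb j }) (λ { (cb _) → refl }) (i Fin.≟ suc j)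
ChainEdge? (a i) (c j)       = map′ (λ { refl → ac i }) (λ { (ac _) → refl }) (j Fin.≟ inject₁ i)
ChainEdge? (a _) (a _)       = no λ ()
ChainEdge? (a _) (b _)       = no λ ()
ChainEdge? (b _) (c _)       = no λ ()
ChainEdge? (b i) (a j)       = map′ (λ { refl → ba i }) (λ { (ba _) → refl }) (i Fin.≟ j)
ChainEdge? (b _) (b _)       = no λ ()

O : ℕ → Graph
O n = record
  { Vertex     = ChainVertex n
  ; order      = chainOrder n
  ; enumerate  = mk↔ₛ′ chainIndex chainVertex (chainIndex-vertex {n}) chainVertex-index
  ; Adj        = SymClosure ChainEdge
  ; Adj-sym    = symmetric _
  ; Adj-irrefl = λ { refl (fwd e) → ChainEdge-irrefl e refl
                   ; refl (bwd e) → ChainEdge-irrefl e refl }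
  ; Adj?       = λ u v → map′ [ fwd , bwd ]
                   (λ { (fwd e) → inj₁ e ; (bwd e) → inj₂ e })
                   (ChainEdge? u v ⊎-dec ChainEdge? v u)
  }

O+e : ℕ → Graph
O+e n = pendant (O n) (c (fromℕ n))

-- The pendant path c_n – p – q, attached one vertex at a time.
O⟨2⟩ : ℕ → Graph
O⟨2⟩ n = pendant (O+e n) nothing

module Submission where

-- Peeling off squares from c₀, the number of dominating sets of a chain of given size obeys a
-- linear recursion F_{n+1} = M F_n, where F_n also depends on how far c₀ is already taken care of
-- from the left (okl, l), and is determined by what happens at cₙ (okr, r).  Attaching a pendant
-- vertex or path at cₙ only replaces F by a combination of such sequences with other okr, r.
-- M is linear and commutes with multiplication by x, so both sides of the claim, read for all
-- states of c₀, satisfy the same recursion and agree as soon as they agree at n = 2.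

open import Defs
open import Algebra.Properties.CommutativeSemigroup using (interchange)
open import Data.Bool.Base using (Bool; true; false; _∧_; _∨_; T; if_then_else_)
open import Data.Bool.Properties using (T-≡; T-∧; T-∨; T?)
open import Data.Empty using (⊥-elim)
open import Data.Fin.Base using (Fin; zero; suc; inject₁; fromℕ)
open import Data.Fin.Relation.Unary.Top using (view; ‵fromℕ; ‵inject₁)
open import Data.Fin.Subset using (Subset; inside; outside; _∈_; ∣_∣)
open import Data.Fin.Subset.Properties using (_∈?_; ∣p∣≤n)
open import Data.List.Base using (List; []; _∷_; _++_; map; filter; length; applyUpTo)
open import Data.List.Membership.Propositional using () renaming (_∈_ to _∈ˡ_)
open import Data.List.Membership.Propositional.Properties using (∈-filter⁻; ∈-applyUpTo⁺; ∈-applyUpTo⁻)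
open import Data.List.Properties using (filter-none; map-++; map-∘)
open import Data.List.Relation.Unary.All as All using (All; []; _∷_)
open import Data.List.Relation.Unary.AllPairs using ([]; _∷_)
open import Data.List.Relation.Unary.Any using (here; there)
open import Data.List.Relation.Unary.Unique.Propositional using (Unique)
import Data.List.Relation.Unary.Unique.Propositional.Properties as Unique
open import Data.Maybe.Base using (just; nothing)
open import Data.Nat.Base using (ℕ; zero; suc; _+_; _*_; _∸_; _≤_; _<_; s≤s; s≤s⁻¹)
open import Data.Nat.Properties
  using (_≟_; _≤?_; ≤-trans; ≤-reflexive; <⇒≢; +-cancelˡ-≡; +-identityʳ; *-identityʳ; *-zeroʳ;
         m≤m+n; m≤n⇒m≤1+n; +-monoʳ-<; m+[n∸m]≡n; ∸-monoˡ-<; +-commutativeSemigroup)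
open import Data.Nat.ListAction using (sum)
open import Data.Nat.ListAction.Properties using (sum-++)
open import Data.Product.Base using (_×_; _,_; ∃; proj₁; proj₂)
open import Data.Sum.Base using (_⊎_; inj₁; inj₂; [_,_])
open import Data.Unit.Base using (tt)
open import Data.Vec.Base using ([]; _∷_; lookup)
open import Data.Vec.Properties using ([]=⇒lookup; lookup⇒[]=)
open import Function.Base using (_∘_; id)
open import Function.Bundles using (_⇔_; mk⇔; module Equivalence)
open import Function.Properties.Equivalence using () renaming (trans to ⇔-trans)
open import Level using (0ℓ)
open import Relation.Binary.Construct.Closure.Symmetric using (fwd; bwd)
open import Relation.Binary.PropositionalEquality
  using (_≡_; _≢_; _≗_; refl; sym; trans; cong; cong₂; subst; module ≡-Reasoning)
open import Relation.Nullary.Decidable using (yes; no; does; does-⇔)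
open import Relation.Nullary.Negation using (contradiction)
open import Relation.Unary using (Decidable; Pred)
open Equivalence using (to; from)

-- Coefficient sequences

Series : Set
Series = ℕ → ℕ

infixl 6 _⊕_

_⊕_ : Series → Series → Series
(F ⊕ H) k = F k + H k

𝟘 : Series
𝟘 _ = 0

-- Multiplication by x.
↑ : Series → Series
↑ F zero    = 0
↑ F (suc k) = F k

⊕-cong : ∀ {F F′ H H′} → F ≗ F′ → H ≗ H′ → F ⊕ H ≗ F′ ⊕ H′
⊕-cong p q k = cong₂ _+_ (p k) (q k)

↑-cong : ∀ {F H} → F ≗ H → ↑ F ≗ ↑ H
↑-cong p zero    = refl
↑-cong p (suc k) = p k

↑-⊕ : ∀ F H → ↑ (F ⊕ H) ≗ ↑ F ⊕ ↑ H
↑-⊕ F H zero    = refl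
↑-⊕ F H (suc k) = refl

-- Coefficients of sums, products and powers

coeff-+ₚ : ∀ p q → coeff (p +ₚ q) ≗ coeff p ⊕ coeff q
coeff-+ₚ []      q       k       = refl
coeff-+ₚ (m ∷ p) []      k       = sym (+-identityʳ _)
coeff-+ₚ (m ∷ p) (n ∷ q) zero    = refl
coeff-+ₚ (m ∷ p) (n ∷ q) (suc k) = coeff-+ₚ p q k

coeff-map-* : ∀ m q k → coeff (map (m *_) q) k ≡ m * coeff q k
coeff-map-* m []      k       = sym (*-zeroʳ m)
coeff-map-* m (n ∷ q) zero    = refl
coeff-map-* m (n ∷ q) (suc k) = coeff-map-* m q k

coeff-∷-*ₚ : ∀ m p q k → coeff ((m ∷ p) *ₚ q) k ≡ m * coeff q k + ↑ (coeff (p *ₚ q)) k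
coeff-∷-*ₚ m p q k = trans (coeff-+ₚ (map (m *_) q) (0 ∷ p *ₚ q) k)
                           (cong₂ _+_ (coeff-map-* m q k) (shift k))
  where
  shift : coeff (0 ∷ p *ₚ q) ≗ ↑ (coeff (p *ₚ q))
  shift zero    = refl
  shift (suc k) = refl

coeff-const-*ₚ : ∀ m q k → coeff (const m *ₚ q) k ≡ m * coeff q k
coeff-const-*ₚ m q k = trans (coeff-∷-*ₚ m [] q k) (trans (cong (m * coeff q k +_) (↑𝟘 k)) (+-identityʳ _))
  where
  ↑𝟘 : ↑ 𝟘 ≗ 𝟘
  ↑𝟘 zero    = refl
  ↑𝟘 (suc _) = refl

coeff-X-*ₚ : ∀ q → coeff (X *ₚ q) ≗ ↑ (coeff q)
coeff-X-*ₚ q k = trans (coeff-∷-*ₚ 0 (1 ∷ []) q k)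
                       (↑-cong (λ j → trans (coeff-const-*ₚ 1 q j) (+-identityʳ _)) k)

coeff-X^-≡ : ∀ i → coeff (X ^ₚ i) i ≡ 1
coeff-X^-≡ zero    = refl
coeff-X^-≡ (suc i) = trans (coeff-X-*ₚ (X ^ₚ i) (suc i)) (coeff-X^-≡ i)

coeff-X^-≢ : ∀ i k → i ≢ k → coeff (X ^ₚ i) k ≡ 0
coeff-X^-≢ zero    zero    i≢k = contradiction refl i≢k
coeff-X^-≢ zero    (suc k) i≢k = refl
coeff-X^-≢ (suc i) zero    i≢k = coeff-X-*ₚ (X ^ₚ i) zero
coeff-X^-≢ (suc i) (suc k) i≢k =
  trans (coeff-X-*ₚ (X ^ₚ i) (suc k)) (coeff-X^-≢ i k (i≢k ∘ cong suc))

module _ (f : ℕ → ℕ) where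

  private
    term : ℕ → Poly
    term i = const (f i) *ₚ X ^ₚ i

    coeff-term-≢ : ∀ {i k} → i ≢ k → coeff (term i) k ≡ 0
    coeff-term-≢ {i} {k} i≢k = trans (coeff-const-*ₚ (f i) (X ^ₚ i) k)
      (trans (cong (f i *_) (coeff-X^-≢ i k i≢k)) (*-zeroʳ (f i)))

    coeff-term-≡ : ∀ i → coeff (term i) i ≡ f i
    coeff-term-≡ i = trans (coeff-const-*ₚ (f i) (X ^ₚ i) i)
      (trans (cong (f i *_) (coeff-X^-≡ i)) (*-identityʳ (f i)))

  coeff-sumₚ-∉ : ∀ {is k} → All (_≢ k) is → coeff (sumₚ (map term is)) k ≡ 0
  coeff-sumₚ-∉               []             = refl
  coeff-sumₚ-∉ {i ∷ is} {k} (i≢k ∷ is≢k) =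
    trans (coeff-+ₚ (term i) (sumₚ (map term is)) k)
          (cong₂ _+_ (coeff-term-≢ i≢k) (coeff-sumₚ-∉ is≢k))

  -- Since the exponents are distinct, exactly one summand contributes to the coefficient at `k`.
  coeff-sumₚ-∈ : ∀ {is k} → Unique is → k ∈ˡ is → coeff (sumₚ (map term is)) k ≡ f k
  coeff-sumₚ-∈ {i ∷ is} {k} (i≢is ∷ _) (here refl) =
    trans (coeff-+ₚ (term i) (sumₚ (map term is)) k)
          (trans (cong₂ _+_ (coeff-term-≡ i) (coeff-sumₚ-∉ (All.map (_∘ sym) i≢is))) (+-identityʳ _))
  coeff-sumₚ-∈ {i ∷ is} {k} (i≢is ∷ u) (there k∈is) =
    trans (coeff-+ₚ (term i) (sumₚ (map term is)) k)
          (cong₂ _+_ (coeff-term-≢ (All.lookup i≢is k∈is)) (coeff-sumₚ-∈ u k∈is))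

-- Coefficients of the domination polynomial

module _ (G : Graph) where
  open Graph G

  d-none : ∀ k → (∀ S → Dominating G S → ∣ S ∣ ≢ k) → d G k ≡ 0
  d-none k none = cong length (filter-none (λ S → ∣ S ∣ ≟ k)
    (All.tabulate λ {S} S∈ → none S (proj₂ (∈-filter⁻ (Dominating? G) {xs = subsets order} S∈))))

  -- The sum defining `D` stops at `γ` and at `order`, but nothing is lost: no dominating set is
  -- smaller than `γ` and no subset is larger than `order`, so `d` vanishes outside this range.
  coeff-D : coeff (D G) ≗ d G
  coeff-D k with γ G ≤? k | k ≤? order
  ... | no γ≰k | _ =
    trans (coeff-sumₚ-∉ (d G) (All.tabulate below))
          (sym (d-none k λ S dom eq → γ≰k (≤-trans (γ-minimal G S dom) (≤-reflexive eq))))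
    where
    below : ∀ {i} → i ∈ˡ applyUpTo (γ G +_) (suc order ∸ γ G) → i ≢ k
    below i∈ refl with ∈-applyUpTo⁻ (γ G +_) i∈
    ... | j , _ , refl = γ≰k (m≤m+n (γ G) j)
  ... | yes γ≤k | no k≰order =
    trans (coeff-sumₚ-∉ (d G) (All.tabulate above))
          (sym (d-none k λ S _ eq → k≰order (≤-trans (≤-reflexive (sym eq)) (∣p∣≤n S))))
    where
    above : ∀ {i} → i ∈ˡ applyUpTo (γ G +_) (suc order ∸ γ G) → i ≢ k
    above i∈ refl with ∈-applyUpTo⁻ (γ G +_) i∈
    -- The list has `suc order ∸ γ G` entries, so its last exponent is `order`. The truncated
    -- subtraction can be undone because `γ G`, being the size of a subset, is at most `order`.
    ... | j , j< , refl = k≰order (s≤s⁻¹ (subst (γ G + j <_)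
            (m+[n∸m]≡n (m≤n⇒m≤1+n (∣p∣≤n (minimumDominatingSet G))))
            (+-monoʳ-< (γ G) j<)))
  ... | yes γ≤k | yes k≤order =
    coeff-sumₚ-∈ (d G)
      (Unique.applyUpTo⁺₁ (γ G +_) _ λ {i} {j} i<j _ eq → <⇒≢ i<j (+-cancelˡ-≡ (γ G) i j eq))
      (subst (_∈ˡ applyUpTo (γ G +_) (suc order ∸ γ G)) (m+[n∸m]≡n γ≤k)
        (∈-applyUpTo⁺ (γ G +_) (∸-monoˡ-< (s≤s k≤order) γ≤k)))

-- Counting subsets by size

-- A generating function computed by deciding one vertex at a time. A member contributes a factor x,
-- hence `↑`, and peeling off the leading vertices is just unfolding.
count : ∀ n → (Subset n → Bool) → Series
count zero    P zero    = if P [] then 1 else 0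
count zero    P (suc k) = 0
count (suc n) P         = count n (P ∘ (outside ∷_)) ⊕ ↑ (count n (P ∘ (inside ∷_)))

count-cong : ∀ n {P Q : Subset n → Bool} → P ≗ Q → count n P ≗ count n Q
count-cong zero    P≗Q zero    = cong (if_then 1 else 0) (P≗Q [])
count-cong zero    P≗Q (suc k) = refl
count-cong (suc n) P≗Q         =
  ⊕-cong (count-cong n (P≗Q ∘ (outside ∷_))) (↑-cong (count-cong n (P≗Q ∘ (inside ∷_))))

count-false : ∀ n → count n (λ _ → false) ≗ 𝟘
count-false zero    zero    = refl
count-false zero    (suc k) = refl
count-false (suc n) zero    = cong (_+ 0) (count-false n zero)
count-false (suc n) (suc k) = cong₂ _+_ (count-false n (suc k)) (count-false n k)

indicator : Bool → ℕ
indicator β = if β then 1 else 0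

sum-indicator : ∀ n (P : Subset n → Bool) k →
                sum (map (λ S → indicator (P S ∧ does (∣ S ∣ ≟ k))) (subsets n)) ≡ count n P k
sum-indicator zero P zero with P []
... | true  = refl
... | false = refl
sum-indicator zero P (suc k) with P []
... | true  = refl
... | false = refl
sum-indicator (suc n) P k = begin
  sum (map g (map (outside ∷_) Ss ++ map (inside ∷_) Ss))
    ≡⟨ cong sum (map-++ g (map (outside ∷_) Ss) _) ⟩
  sum (map g (map (outside ∷_) Ss) ++ map g (map (inside ∷_) Ss))
    ≡⟨ sum-++ (map g (map (outside ∷_) Ss)) _ ⟩
  sum (map g (map (outside ∷_) Ss)) + sum (map g (map (inside ∷_) Ss))
    ≡⟨ cong₂ _+_ (cong sum (sym (map-∘ Ss))) (cong sum (sym (map-∘ Ss))) ⟩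
  sum (map (g ∘ (outside ∷_)) Ss) + sum (map (g ∘ (inside ∷_)) Ss)
    ≡⟨ cong₂ _+_ (sum-indicator n (P ∘ (outside ∷_)) k) (insides k) ⟩
  count (suc n) P k ∎
  where
  open ≡-Reasoning
  Ss = subsets n
  g : Subset (suc n) → ℕ
  g S = indicator (P S ∧ does (∣ S ∣ ≟ k))

  all-zero : ∀ (xs : List (Subset n)) → sum (map (λ S → indicator (P (inside ∷ S) ∧ false)) xs) ≡ 0
  all-zero []       = refl
  all-zero (S ∷ xs) with P (inside ∷ S)
  ... | true  = all-zero xs
  ... | false = all-zero xs

  insides : ∀ k → sum (map (λ S → indicator (P (inside ∷ S) ∧ does (suc ∣ S ∣ ≟ k))) Ss)
                ≡ ↑ (count n (P ∘ (inside ∷_))) k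
  insides zero    = all-zero Ss
  insides (suc k) = sum-indicator n (P ∘ (inside ∷_)) k

length-filter-filter : ∀ {A : Set} {P Q : Pred A 0ℓ} (P? : Decidable P) (Q? : Decidable Q) xs →
                       length (filter Q? (filter P? xs)) ≡
                       sum (map (λ x → indicator (does (P? x) ∧ does (Q? x))) xs)
length-filter-filter P? Q? []       = refl
length-filter-filter P? Q? (x ∷ xs) with does (P? x)
... | false = length-filter-filter P? Q? xs
... | true  with does (Q? x)
...   | true  = cong suc (length-filter-filter P? Q? xs)
...   | false = length-filter-filter P? Q? xs

-- Any Boolean test equivalent to domination may replace the decision procedure, so a test that
-- recurses along the chain can be counted instead.
coeff-D-count : ∀ G (P : Subset (Graph.order G) → Bool) →
                (∀ S → Dominating G S ⇔ T (P S)) → coeff (D G) ≗ count (Graph.order G) P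
coeff-D-count G P dom⇔P k = begin
  coeff (D G) k                                 ≡⟨ coeff-D G k ⟩
  d G k                                         ≡⟨ length-filter-filter (Dominating? G) _ (subsets order) ⟩
  sum (map (λ S → indicator (does (Dominating? G S) ∧ does (∣ S ∣ ≟ k))) (subsets order))
                                                ≡⟨ sum-indicator order (does ∘ Dominating? G) k ⟩
  count order (does ∘ Dominating? G) k          ≡⟨ count-cong order agree k ⟩
  count order P k                               ∎
  where
  open ≡-Reasoning
  open Graph G

  agree : does ∘ Dominating? G ≗ P
  agree S = does-⇔ (dom⇔P S) (Dominating? G S) (T? (P S))

-- Domination with a vertex that may be covered from outside

module _ (G : Graph) (w : Graph.Vertex G) where
  open Graph G

  -- The flag `r` stands for a neighbour of `w` outside `G` that belongs to the dominating set, as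
  -- happens when a pendant vertex is removed.
  Covered : Bool → Subset order → Vertex → Set
  Covered r S v =
    T (lookup S (index v)) ⊎ (T r × v ≡ w) ⊎ ∃ λ u → T (lookup S (index u)) × Adj u v

  DominatingUpTo : Bool → Subset order → Set
  DominatingUpTo r S = ∀ v → Covered r S v

∈⇒T : ∀ {n} {S : Subset n} {i} → i ∈ S → T (lookup S i)
∈⇒T = from T-≡ ∘ []=⇒lookup

T⇒∈ : ∀ {n} (S : Subset n) i → T (lookup S i) → i ∈ S
T⇒∈ S i = lookup⇒[]= i S ∘ to T-≡

-- With the flag `false` the outside covers nothing, so any `w` will do. Decidability of membership
-- turns the implication in `Dominating` into a disjunction.
Dominating⇔ : ∀ G w S → Dominating G S ⇔ DominatingUpTo G w false S
Dominating⇔ G w S = mk⇔ ⇒ ⇐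
  where
  open Graph G
  ⇒ : Dominating G S → DominatingUpTo G w false S
  ⇒ dom v with index v ∈? S
  ... | yes v∈S = inj₁ (∈⇒T v∈S)
  ... | no  v∉S with dom v v∉S
  ...   | u , u∈S , uv = inj₂ (inj₂ (u , ∈⇒T u∈S , uv))
  ⇐ : DominatingUpTo G w false S → Dominating G S
  ⇐ dom v v∉S with dom v
  ... | inj₁ v∈S                   = contradiction (T⇒∈ S _ v∈S) v∉S
  ... | inj₂ (inj₂ (u , u∈S , uv)) = u , T⇒∈ S _ u∈S , uv

-- The new vertex is a member, or covered from outside, or covered by its only neighbour `w`. The
-- old vertices see the new one only at `w`, so its membership `p` becomes their outside flag.
DominatingUpTo-pendant : ∀ G w q p S →
  DominatingUpTo (pendant G w) nothing q (p ∷ S) ⇔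
  (T (p ∨ q ∨ lookup S (Graph.index G w)) × DominatingUpTo G w p S)
DominatingUpTo-pendant G w q p S = mk⇔ (λ dom → at-new (dom nothing) , λ v → at-old v (dom (just v))) ⇐
  where
  open Graph G
  at-new : Covered (pendant G w) nothing q (p ∷ S) nothing → T (p ∨ q ∨ lookup S (index w))
  at-new (inj₁ p∈)                          = from T-∨ (inj₁ p∈)
  at-new (inj₂ (inj₁ (q∈ , _)))             = from (T-∨ {p}) (inj₂ (from T-∨ (inj₁ q∈)))
  at-new (inj₂ (inj₂ (_ , w∈ , fwd new)))   = from (T-∨ {p}) (inj₂ (from (T-∨ {q}) (inj₂ w∈)))
  at-new (inj₂ (inj₂ (_ , _ , bwd ())))

  at-old : ∀ v → Covered (pendant G w) nothing q (p ∷ S) (just v) → Covered G w p S v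
  at-old v (inj₁ v∈)                                   = inj₁ v∈
  at-old v (inj₂ (inj₁ (_ , ())))
  at-old v (inj₂ (inj₂ (just u , u∈ , fwd (old e))))   = inj₂ (inj₂ (u , u∈ , e))
  at-old v (inj₂ (inj₂ (just u , u∈ , bwd (old e))))   = inj₂ (inj₂ (u , u∈ , Adj-sym e))
  at-old v (inj₂ (inj₂ (nothing , p∈ , bwd new)))      = inj₂ (inj₁ (p∈ , refl))

  ⇐ : T (p ∨ q ∨ lookup S (index w)) × DominatingUpTo G w p S →
      DominatingUpTo (pendant G w) nothing q (p ∷ S)
  ⇐ (pqw , dom) nothing with to (T-∨ {p}) pqw
  ... | inj₁ p∈ = inj₁ p∈
  ... | inj₂ qw with to (T-∨ {q}) qw
  ...   | inj₁ q∈ = inj₂ (inj₁ (q∈ , refl))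
  ...   | inj₂ w∈ = inj₂ (inj₂ (just w , w∈ , fwd new))
  ⇐ (pqw , dom) (just v) with dom v
  ... | inj₁ v∈                    = inj₁ v∈
  ... | inj₂ (inj₁ (p∈ , refl))    = inj₂ (inj₂ (nothing , p∈ , bwd new))
  ... | inj₂ (inj₂ (u , u∈ , uv))  = inj₂ (inj₂ (just u , u∈ , fwd (old uv)))

-- Domination in an ortho-chain

member : ∀ n → Subset (chainOrder n) → ChainVertex n → Bool
member n S v = lookup S (chainIndex v)

-- Whether c j is adjacent to a member of S in the square to its left; for c₀, which has none, the answer is l.
leftCover : ∀ n → Bool → Subset (chainOrder n) → Fin (suc n) → Bool
leftCover n       l S               zero    = l
leftCover (suc n) l (x ∷ y ∷ z ∷ S) (suc j) = leftCover n (x ∨ z) S j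

-- The mirror image of `leftCover`: here the exceptional cut-vertex is the last one, with answer
-- `r`. The bits `x`, `y`, `z` belong to c₀, a₁, b₁, in the order of `chainIndex`.
rightCover : ∀ n → Bool → Subset (chainOrder n) → Fin (suc n) → Bool
rightCover zero    r S               zero    = r
rightCover (suc n) r (x ∷ y ∷ z ∷ S) zero    = y ∨ member n S (c zero)
rightCover (suc n) r (x ∷ y ∷ z ∷ S) (suc j) = rightCover n r S j

-- Links the recursive scan, which suits peeling, to the two actual neighbours on the left, which
-- suit the case analysis on edges.
leftCover-suc : ∀ n l S (i : Fin n) →
                leftCover n l S (suc i) ≡ member n S (c (inject₁ i)) ∨ member n S (b i)
leftCover-suc (suc n) l (x ∷ y ∷ z ∷ S) zero    = refl
leftCover-suc (suc n) l (x ∷ y ∷ z ∷ S) (suc i) = leftCover-suc n (x ∨ z) S i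

rightCover-inject₁ : ∀ n r S (i : Fin n) →
                     rightCover n r S (inject₁ i) ≡ member n S (a i) ∨ member n S (c (suc i))
rightCover-inject₁ (suc n) r (x ∷ y ∷ z ∷ S) zero    = refl
rightCover-inject₁ (suc n) r (x ∷ y ∷ z ∷ S) (suc i) = rightCover-inject₁ n r S i

rightCover-fromℕ : ∀ n r S → rightCover n r S (fromℕ n) ≡ r
rightCover-fromℕ zero    r S               = refl
rightCover-fromℕ (suc n) r (x ∷ y ∷ z ∷ S) = rightCover-fromℕ n r S

-- Each condition runs over a closed neighbourhood. The flag `l`, which `DominatingUpTo` lacks,
-- remembers what the squares already peeled off do for c₀.
record ChainDominating n (l r : Bool) (S : Subset (chainOrder n)) : Set where
  field
    c-covered : ∀ j → T (member n S (c j) ∨ leftCover n l S j ∨ rightCover n r S j)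
    a-covered : ∀ i → T (member n S (c (inject₁ i)) ∨ member n S (a i) ∨ member n S (b i))
    b-covered : ∀ i → T (member n S (a i) ∨ member n S (b i) ∨ member n S (c (suc i)))
open ChainDominating

T-∨³ : ∀ x y {z} → T (x ∨ y ∨ z) ⇔ (T x ⊎ T y ⊎ T z)
T-∨³ true  y     = mk⇔ inj₁ _
T-∨³ false true  = mk⇔ (inj₂ ∘ inj₁) _
T-∨³ false false = mk⇔ (inj₂ ∘ inj₂) [ ⊥-elim , [ ⊥-elim , id ] ]

DominatingUpTo-O : ∀ n r S →
  DominatingUpTo (O n) (c (fromℕ n)) r S ⇔ ChainDominating n false r S
DominatingUpTo-O n r S = mk⇔ ⇒ ⇐
  where
  L = leftCover n false S
  R = rightCover n r S
  Cov = Covered (O n) (c (fromℕ n)) r S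

  in-L : ∀ i → T (member n S (c (inject₁ i))) ⊎ T (member n S (b i)) → T (L (suc i))
  in-L i m = subst T (sym (leftCover-suc n false S i)) (from T-∨ m)

  in-R : ∀ i → T (member n S (a i)) ⊎ T (member n S (c (suc i))) → T (R (inject₁ i))
  in-R i m = subst T (sym (rightCover-inject₁ n r S i)) (from T-∨ m)

  at-c : ∀ j → Cov (c j) → T (member n S (c j)) ⊎ T (L j) ⊎ T (R j)
  at-c j (inj₁ m)                            = inj₁ m
  at-c j (inj₂ (inj₁ (tr , refl)))           = inj₂ (inj₂ (subst T (sym (rightCover-fromℕ n r S)) tr))
  at-c _ (inj₂ (inj₂ (_ , m , fwd (cc i))))  = inj₂ (inj₁ (in-L i (inj₁ m)))
  at-c _ (inj₂ (inj₂ (_ , m , fwd (ac i))))  = inj₂ (inj₂ (in-R i (inj₁ m)))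
  at-c _ (inj₂ (inj₂ (_ , m , bwd (cc i))))  = inj₂ (inj₂ (in-R i (inj₂ m)))
  at-c _ (inj₂ (inj₂ (_ , m , bwd (cb i))))  = inj₂ (inj₁ (in-L i (inj₂ m)))

  at-a : ∀ i → Cov (a i) → T (member n S (c (inject₁ i))) ⊎ T (member n S (a i)) ⊎ T (member n S (b i))
  at-a i (inj₁ m)                            = inj₂ (inj₁ m)
  at-a i (inj₂ (inj₂ (_ , m , fwd (ba .i)))) = inj₂ (inj₂ m)
  at-a i (inj₂ (inj₂ (_ , m , bwd (ac .i)))) = inj₁ m

  at-b : ∀ i → Cov (b i) → T (member n S (a i)) ⊎ T (member n S (b i)) ⊎ T (member n S (c (suc i)))
  at-b i (inj₁ m)                            = inj₂ (inj₁ m)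
  at-b i (inj₂ (inj₂ (_ , m , fwd (cb .i)))) = inj₂ (inj₂ m)
  at-b i (inj₂ (inj₂ (_ , m , bwd (ba .i)))) = inj₁ m

  ⇒ : DominatingUpTo (O n) (c (fromℕ n)) r S → ChainDominating n false r S
  ⇒ dom = record
    { c-covered = λ j → from (T-∨³ _ _) (at-c j (dom (c j)))
    ; a-covered = λ i → from (T-∨³ _ _) (at-a i (dom (a i)))
    ; b-covered = λ i → from (T-∨³ _ _) (at-b i (dom (b i)))
    }

  from-L : ∀ j → T (L j) → Cov (c j)
  -- Nothing lies to the left of c₀, so its left cover is the starting value `false`.
  from-L zero    ()
  from-L (suc i) t with to T-∨ (subst T (leftCover-suc n false S i) t)
  ... | inj₁ m = inj₂ (inj₂ (c (inject₁ i) , m , fwd (cc i)))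
  ... | inj₂ m = inj₂ (inj₂ (b i , m , bwd (cb i)))

  from-R : ∀ j → T (R j) → Cov (c j)
  -- Only the last cut-vertex has no square to its right; there the cover must come from outside.
  from-R j t with view j
  ... | ‵fromℕ     = inj₂ (inj₁ (subst T (rightCover-fromℕ n r S) t , refl))
  ... | ‵inject₁ i with to T-∨ (subst T (rightCover-inject₁ n r S i) t)
  ...   | inj₁ m = inj₂ (inj₂ (a i , m , fwd (ac i)))
  ...   | inj₂ m = inj₂ (inj₂ (c (suc i) , m , bwd (cc i)))

  ⇐ : ChainDominating n false r S → DominatingUpTo (O n) (c (fromℕ n)) r S
  ⇐ dom (c j) with to (T-∨³ _ _) (c-covered dom j)
  ... | inj₁ m        = inj₁ m
  ... | inj₂ (inj₁ t) = from-L j t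
  ... | inj₂ (inj₂ t) = from-R j t
  ⇐ dom (a i) with to (T-∨³ _ _) (a-covered dom i)
  ... | inj₁ m        = inj₂ (inj₂ (c (inject₁ i) , m , bwd (ac i)))
  ... | inj₂ (inj₁ m) = inj₁ m
  ... | inj₂ (inj₂ m) = inj₂ (inj₂ (b i , m , fwd (ba i)))
  ⇐ dom (b i) with to (T-∨³ _ _) (b-covered dom i)
  ... | inj₁ m        = inj₂ (inj₂ (a i , m , bwd (ba i)))
  ... | inj₂ (inj₁ m) = inj₁ m
  ... | inj₂ (inj₂ m) = inj₂ (inj₂ (c (suc i) , m , fwd (cb i)))

-- l and r say whether c₀ and cₙ count as covered from outside the chain;
-- if okl (okr) is false then c₀ (cₙ) is required to be a member.
chainDominating : ∀ n (okl l okr r : Bool) → Subset (chainOrder n) → Bool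
chainDominating zero    okl l okr r (x ∷ [])        = (okl ∨ x) ∧ (okr ∨ x) ∧ (x ∨ l ∨ r)
chainDominating (suc n) okl l okr r (x ∷ y ∷ z ∷ S) =
  ((okl ∨ x) ∧ (x ∨ y ∨ z)) ∧ chainDominating n ((x ∨ l ∨ y) ∧ (y ∨ z)) (x ∨ z) okr r S

-- Covering the first cut-vertex and b₁ amounts to a condition on c₁ alone once the other three are fixed.
T-next : ∀ x l y z h → T ((x ∨ l ∨ y) ∧ (y ∨ z) ∨ h) ⇔ (T (x ∨ l ∨ y ∨ h) × T (y ∨ z ∨ h))
T-next true  l     true  z     h     = mk⇔ _ _
T-next false true  true  z     h     = mk⇔ _ _
T-next false false true  z     h     = mk⇔ _ _
T-next true  l     false true  h     = mk⇔ _ _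
T-next true  l     false false h     = mk⇔ (tt ,_) proj₂
T-next false true  false true  h     = mk⇔ _ _
T-next false true  false false h     = mk⇔ (tt ,_) proj₂
T-next false false false true  h     = mk⇔ (_, tt) proj₁
T-next false false false false h     = mk⇔ (λ t → t , t) proj₁

-- Induction along the chain. The condition on a₁ involves only the three bits peeled off. Those on
-- c₀ and b₁ may still call for c₁, which is what the next `okl` records, and the cover that c₀ and
-- b₁ give to c₁ is the next `l`.
chainDominating⇔ : ∀ n okl l okr r S →
  T (chainDominating n okl l okr r S) ⇔
  (T (okl ∨ member n S (c zero)) × T (okr ∨ member n S (c (fromℕ n))) × ChainDominating n l r S)
chainDominating⇔ zero okl l okr r (x ∷ []) = mk⇔
  (λ t → let t₁ , t′ = to (T-∧ {okl ∨ x}) t ; t₂ , t₃ = to (T-∧ {okr ∨ x}) t′ in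
         t₁ , t₂ , record { c-covered = λ { zero → t₃ ; (suc ()) } ; a-covered = λ () ; b-covered = λ () })
  (λ (t₁ , t₂ , dom) → from T-∧ (t₁ , from T-∧ (t₂ , c-covered dom zero)))
chainDominating⇔ (suc n) okl l okr r (x ∷ y ∷ z ∷ S) = mk⇔ ⇒ ⇐
  where
  h  = member n S (c zero)
  S⁺ = x ∷ y ∷ z ∷ S

  Condition : Set
  Condition = T (okl ∨ member (suc n) S⁺ (c zero)) × T (okr ∨ member (suc n) S⁺ (c (fromℕ (suc n)))) ×
              ChainDominating (suc n) l r S⁺

  IH : T (chainDominating n ((x ∨ l ∨ y) ∧ (y ∨ z)) (x ∨ z) okr r S) ⇔
       (T ((x ∨ l ∨ y) ∧ (y ∨ z) ∨ h) × T (okr ∨ member n S (c (fromℕ n))) × ChainDominating n (x ∨ z) r S)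
  IH = chainDominating⇔ n _ _ okr r S

  ⇒ : T (chainDominating (suc n) okl l okr r S⁺) → Condition
  ⇒ t =
    let t₀ , rest      = to (T-∧ {(okl ∨ x) ∧ (x ∨ y ∨ z)}) t
        t₁ , t₂        = to (T-∧ {okl ∨ x}) t₀
        next , t₃ , dom = to IH rest
        t₄ , t₅        = to (T-next x l y z h) next
    in t₁ , t₃ , record
         { c-covered = λ { zero → t₄ ; (suc j) → c-covered dom j }
         ; a-covered = λ { zero → t₂ ; (suc i) → a-covered dom i }
         ; b-covered = λ { zero → t₅ ; (suc i) → b-covered dom i }
         }

  ⇐ : Condition → T (chainDominating (suc n) okl l okr r S⁺)
  ⇐ (t₁ , t₃ , dom) = from T-∧
    ( from T-∧ (t₁ , a-covered dom zero)
    , from IH ( from (T-next x l y z h) (c-covered dom zero , b-covered dom zero) , t₃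
              , record { c-covered = c-covered dom ∘ suc
                       ; a-covered = a-covered dom ∘ suc
                       ; b-covered = b-covered dom ∘ suc }))

DominatingUpTo-O-chainDominating : ∀ n okr r S →
  (T (okr ∨ member n S (c (fromℕ n))) × DominatingUpTo (O n) (c (fromℕ n)) r S) ⇔
  T (chainDominating n true false okr r S)
DominatingUpTo-O-chainDominating n okr r S = mk⇔
  (λ (t , dom) → from chain (tt , t , to (DominatingUpTo-O n r S) dom))
  (λ t → let _ , t′ , dom = to chain t in t′ , from (DominatingUpTo-O n r S) dom)
  where chain = chainDominating⇔ n true false okr r S

-- Boolean tests for the three graphs

module _ (n : ℕ) where

  dominatingO : Subset (chainOrder n) → Bool
  dominatingO = chainDominating n true false true false

  dominatingO+e : Subset (suc (chainOrder n)) → Bool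
  dominatingO+e (p ∷ S) = chainDominating n true false p p S

  dominatingO⟨2⟩ : Subset (suc (suc (chainOrder n))) → Bool
  dominatingO⟨2⟩ (q ∷ p ∷ S) = (q ∨ p) ∧ chainDominating n true false true p S

  private
    end = c (fromℕ n)

  Dominating-O : ∀ S → Dominating (O n) S ⇔ T (dominatingO S)
  Dominating-O S = ⇔-trans (Dominating⇔ (O n) end S)
    (⇔-trans (mk⇔ (tt ,_) proj₂) (DominatingUpTo-O-chainDominating n true false S))

  Dominating-O+e : ∀ S → Dominating (O+e n) S ⇔ T (dominatingO+e S)
  Dominating-O+e (p ∷ S) = ⇔-trans (Dominating⇔ (O+e n) nothing (p ∷ S))
    (⇔-trans (DominatingUpTo-pendant (O n) end false p S)
             (DominatingUpTo-O-chainDominating n p p S))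

  -- Dominating the outer path vertex means that one of the two path vertices is a member, and this
  -- dominates the inner one as well. So `c (fromℕ n)` is never forced, and only the inner vertex
  -- `p` can cover it.
  Dominating-O⟨2⟩ : ∀ S → Dominating (O⟨2⟩ n) S ⇔ T (dominatingO⟨2⟩ S)
  Dominating-O⟨2⟩ (q ∷ p ∷ S) = ⇔-trans (Dominating⇔ (O⟨2⟩ n) nothing (q ∷ p ∷ S))
    (⇔-trans (DominatingUpTo-pendant (O+e n) nothing false q (p ∷ S)) (mk⇔ ⇒ ⇐))
    where
    inner = DominatingUpTo-pendant (O n) end q p S
    chain = DominatingUpTo-O-chainDominating n true p S

    q∨p⇒ : ∀ q p {m} → T (q ∨ p) → T (p ∨ q ∨ m)
    q∨p⇒ q     true  _ = tt
    q∨p⇒ true  false _ = tt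

    ⇒ : T (q ∨ p) × DominatingUpTo (O+e n) nothing q (p ∷ S) → T (dominatingO⟨2⟩ (q ∷ p ∷ S))
    ⇒ (t , dom) = from T-∧ (t , to chain (tt , proj₂ (to inner dom)))

    ⇐ : T (dominatingO⟨2⟩ (q ∷ p ∷ S)) → T (q ∨ p) × DominatingUpTo (O+e n) nothing q (p ∷ S)
    ⇐ t = let t₁ , t₂ = to (T-∧ {q ∨ p}) t in
          t₁ , from inner (q∨p⇒ q p t₁ , proj₂ (from chain t₂))

-- The transfer operator of a square

-- The shape of one unfolding of `count`; three in a row handle c₀, a₁ and b₁, the vertices that one
-- square adds.
branch : (Bool → Series) → Series
branch f = f false ⊕ ↑ (f true)

branch-cong : ∀ f g → (∀ β → f β ≗ g β) → branch f ≗ branch g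
branch-cong f g f≗g k = cong₂ _+_ (f≗g false k) (↑-cong (f≗g true) k)

branch-⊕ : ∀ f g → branch (λ β → f β ⊕ g β) ≗ branch f ⊕ branch g
branch-⊕ f g k = trans (cong ((f false ⊕ g false) k +_) (↑-⊕ (f true) (g true) k))
  (interchange +-commutativeSemigroup (f false k) (g false k) (↑ (f true) k) (↑ (g true) k))

branch-↑ : ∀ f → branch (↑ ∘ f) ≗ ↑ (branch f)
branch-↑ f zero    = refl
branch-↑ f (suc k) = refl

branch³ : (Bool → Bool → Bool → Series) → Series
branch³ f = branch λ x → branch λ y → branch (f x y)

branch³-cong : ∀ f g → (∀ x y z → f x y z ≗ g x y z) → branch³ f ≗ branch³ g
branch³-cong f g f≗g =
  branch-cong _ (λ x → branch λ y → branch (g x y)) λ x →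
  branch-cong _ (λ y → branch (g x y)) λ y →
  branch-cong (f x y) (g x y) (f≗g x y)

branch³-⊕ : ∀ f g → branch³ (λ x y z → f x y z ⊕ g x y z) ≗ branch³ f ⊕ branch³ g
branch³-⊕ f g k = trans
  (branch-cong _ (λ x → f₂ x ⊕ g₂ x) (λ x j → trans
    (branch-cong _ (λ y → f₁ x y ⊕ g₁ x y) (λ y → branch-⊕ (f x y) (g x y)) j)
    (branch-⊕ (f₁ x) (g₁ x) j)) k)
  (branch-⊕ f₂ g₂ k)
  where
  f₁ g₁ : Bool → Bool → Series
  f₁ x y = branch (f x y)
  g₁ x y = branch (g x y)
  f₂ g₂ : Bool → Series
  f₂ x = branch (f₁ x)
  g₂ x = branch (g₁ x)

branch³-↑ : ∀ f → branch³ (λ x y z → ↑ (f x y z)) ≗ ↑ (branch³ f)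
branch³-↑ f k = trans
  (branch-cong _ (λ x → ↑ (f₂ x)) (λ x j → trans
    (branch-cong _ (λ y → ↑ (f₁ x y)) (λ y → branch-↑ (f x y)) j)
    (branch-↑ (f₁ x) j)) k)
  (branch-↑ f₂ k)
  where
  f₁ : Bool → Bool → Series
  f₁ x y = branch (f x y)
  f₂ : Bool → Series
  f₂ x = branch (f₁ x)

guard : Bool → Series → Series
guard g F = if g then F else 𝟘

count-guard : ∀ n g (P : Subset n → Bool) → count n (λ S → g ∧ P S) ≗ guard g (count n P)
count-guard n true  P k = refl
count-guard n false P   = count-false n

guard-cong : ∀ g {F H} → F ≗ H → guard g F ≗ guard g H
guard-cong true  F≗H   = F≗H
guard-cong false F≗H k = refl

guard-⊕ : ∀ g F H → guard g (F ⊕ H) ≗ guard g F ⊕ guard g H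
guard-⊕ true  F H k = refl
guard-⊕ false F H k = refl

guard-↑ : ∀ g F → guard g (↑ F) ≗ ↑ (guard g F)
guard-↑ true  F k       = refl
guard-↑ false F zero    = refl
guard-↑ false F (suc k) = refl

-- The arguments are the state okl, l of the first cut-vertex.
Family : Set
Family = Bool → Bool → Series

-- The contribution of the sets whose members among the first cut-vertex, a₁ and b₁ are given by x, y and z.
stepTerm : Family → (okl l x y z : Bool) → Series
stepTerm F okl l x y z = guard ((okl ∨ x) ∧ (x ∨ y ∨ z)) (F ((x ∨ l ∨ y) ∧ (y ∨ z)) (x ∨ z))

-- The operator M. It sees neither the length of the chain nor `okr` and `r`, so the same operator
-- serves every attachment at the far end.
step : Family → Family
step F okl l = branch³ (stepTerm F okl l)

infix 4 _≋_
infixl 6 _⊞_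

_≋_ : Family → Family → Set
F ≋ H = ∀ okl l → F okl l ≗ H okl l

_⊞_ : Family → Family → Family
(F ⊞ H) okl l = F okl l ⊕ H okl l

↥ : Family → Family
↥ F okl l = ↑ (F okl l)

step-cong : ∀ {F H} → F ≋ H → step F ≋ step H
step-cong {F} {H} F≋H okl l = branch³-cong (stepTerm F okl l) (stepTerm H okl l) λ x y z →
  guard-cong ((okl ∨ x) ∧ (x ∨ y ∨ z)) (F≋H _ _)

step-⊞ : ∀ F H → step (F ⊞ H) ≋ step F ⊞ step H
step-⊞ F H okl l k = trans
  (branch³-cong (stepTerm (F ⊞ H) okl l) (λ x y z → stepTerm F okl l x y z ⊕ stepTerm H okl l x y z)
    (λ x y z → guard-⊕ ((okl ∨ x) ∧ (x ∨ y ∨ z)) _ _) k)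
  (branch³-⊕ (stepTerm F okl l) (stepTerm H okl l) k)

step-↥ : ∀ F → step (↥ F) ≋ ↥ (step F)
step-↥ F okl l k = trans
  (branch³-cong (stepTerm (↥ F) okl l) (λ x y z → ↑ (stepTerm F okl l x y z))
    (λ x y z → guard-↑ ((okl ∨ x) ∧ (x ∨ y ∨ z)) _) k)
  (branch³-↑ (stepTerm F okl l) k)

-- Sequences of families driven by the transfer operator

record Evolves (Φ : ℕ → Family) : Set where
  field next : ∀ n → Φ (suc n) ≋ step (Φ n)
open Evolves

evolves-⊞ : ∀ {Φ Ψ} → Evolves Φ → Evolves Ψ → Evolves (λ n → Φ n ⊞ Ψ n)
evolves-⊞ {Φ} {Ψ} p q .next n okl l k =
  trans (⊕-cong (next p n okl l) (next q n okl l) k) (sym (step-⊞ (Φ n) (Ψ n) okl l k))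

evolves-↥ : ∀ {Φ} → Evolves Φ → Evolves (λ n → ↥ (Φ n))
evolves-↥ {Φ} p .next n okl l k = trans (↑-cong (next p n okl l) k) (sym (step-↥ (Φ n) okl l k))

evolves-suc : ∀ {Φ} → Evolves Φ → Evolves (λ n → Φ (suc n))
evolves-suc p .next n = next p (suc n)

evolves-unique : ∀ {Φ Ψ} → Evolves Φ → Evolves Ψ → Φ 0 ≋ Ψ 0 → ∀ n → Φ n ≋ Ψ n
evolves-unique p q base zero            = base
evolves-unique p q base (suc n) okl l k = trans (next p n okl l k)
  (trans (step-cong (evolves-unique p q base n) okl l k) (sym (next q n okl l k)))

chainCount : (okr r : Bool) → ℕ → Family
chainCount okr r n okl l = count (chainOrder n) (chainDominating n okl l okr r)

-- Three unfoldings of `count` already have the form `branch³`; it only remains to pull the test on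
-- the peeled bits out of the count as a guard.
evolves-chainCount : ∀ okr r → Evolves (chainCount okr r)
evolves-chainCount okr r .next n okl l =
  branch³-cong _ (stepTerm (chainCount okr r n) okl l) λ x y z →
  count-guard (chainOrder n) ((okl ∨ x) ∧ (x ∨ y ∨ z)) _

-- okr and r encode the attachment at cₙ: the pendant vertex of O+e either is a member, and
-- covers cₙ, or forces cₙ to be a member.
pendantCount : ℕ → Family
pendantCount n = chainCount false false n ⊞ ↥ (chainCount true true n)

-- The two summands separate the sets by membership of the outer path vertex, whose absence forces the inner one.
pathCount : ℕ → Family
pathCount n = ↥ (chainCount true true n) ⊞ ↥ (chainCount true false n ⊞ ↥ (chainCount true true n))

-- The right-hand side of the claim for chain length n + 2, with x² + 2x written as x(1 + 1 + x).
recurrence : ℕ → Family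
recurrence n =
  ↥ (chainCount true false (suc n))
  ⊞ ↥ (pendantCount (suc n) ⊞ pendantCount (suc n) ⊞ ↥ (pendantCount (suc n)))
  ⊞ ↥ (↥ (pathCount n))

evolves-recurrence : Evolves recurrence
evolves-recurrence =
  evolves-⊞ (evolves-⊞ (evolves-↥ (evolves-suc α))
                       (evolves-↥ (evolves-⊞ (evolves-⊞ π π) (evolves-↥ π))))
            (evolves-↥ (evolves-↥ (evolves-⊞ (evolves-↥ β) (evolves-↥ (evolves-⊞ α (evolves-↥ β))))))
  where
  α = evolves-chainCount true false
  β = evolves-chainCount true true
  π = evolves-suc (evolves-⊞ (evolves-chainCount false false) (evolves-↥ β))

-- Equality is proved in every state of c₀ because `step` feeds each state from others; agreement in
-- the state `true`, `false` alone would not carry the induction.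
chainCount-recurrence : ∀ n → chainCount true false (suc (suc n)) ≋ recurrence n
chainCount-recurrence =
  evolves-unique (evolves-suc (evolves-suc (evolves-chainCount true false))) evolves-recurrence base
  where
  -- O₂ has seven vertices, so both sides have degree at most 7.
  base : chainCount true false 2 ≋ recurrence 0
  base true true 0 = refl
  base true true 1 = refl
  base true true 2 = refl
  base true true 3 = refl
  base true true 4 = refl
  base true true 5 = refl
  base true true 6 = refl
  base true true 7 = refl
  base true true (suc (suc (suc (suc (suc (suc (suc (suc _)))))))) = refl
  base true false 0 = refl
  base true false 1 = refl
  base true false 2 = refl
  base true false 3 = refl
  base true false 4 = refl
  base true false 5 = refl
  base true false 6 = refl
  base true false 7 = refl
  base true false (suc (suc (suc (suc (suc (suc (suc (suc _)))))))) = refl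
  base false true 0 = refl
  base false true 1 = refl
  base false true 2 = refl
  base false true 3 = refl
  base false true 4 = refl
  base false true 5 = refl
  base false true 6 = refl
  base false true 7 = refl
  base false true (suc (suc (suc (suc (suc (suc (suc (suc _)))))))) = refl
  base false false 0 = refl
  base false false 1 = refl
  base false false 2 = refl
  base false false 3 = refl
  base false false 4 = refl
  base false false 5 = refl
  base false false 6 = refl
  base false false 7 = refl
  base false false (suc (suc (suc (suc (suc (suc (suc (suc _)))))))) = refl

-- From families back to polynomials

coeff-X²-*ₚ : ∀ p → coeff (X ^ₚ 2 *ₚ p) ≗ ↑ (↑ (coeff p))
coeff-X²-*ₚ p k = trans (coeff-∷-*ₚ 0 (0 ∷ 1 ∷ []) p k) (↑-cong (coeff-X-*ₚ p) k)

-- The factor evaluates to the list 0, 2, 1, that is x(2 + x). The double is spelled out as a sum to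
-- match `recurrence`.
coeff-X²+2X-*ₚ : ∀ p → coeff ((X ^ₚ 2 +ₚ const 2 *ₚ X) *ₚ p) ≗ ↑ ((coeff p ⊕ coeff p) ⊕ ↑ (coeff p))
coeff-X²+2X-*ₚ p k = trans (coeff-∷-*ₚ 0 (2 ∷ 1 ∷ []) p k) (↑-cong linear k)
  where
  linear : coeff ((2 ∷ 1 ∷ []) *ₚ p) ≗ (coeff p ⊕ coeff p) ⊕ ↑ (coeff p)
  linear k = trans (coeff-∷-*ₚ 2 (1 ∷ []) p k)
    (cong₂ _+_ (cong (coeff p k +_) (+-identityʳ _))
               (↑-cong (λ j → trans (coeff-const-*ₚ 1 p j) (+-identityʳ _)) k))

coeff-D-O : ∀ n → coeff (D (O n)) ≗ chainCount true false n true false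
coeff-D-O n = coeff-D-count (O n) (dominatingO n) (Dominating-O n)

coeff-D-O+e : ∀ n → coeff (D (O+e n)) ≗ pendantCount n true false
coeff-D-O+e n = coeff-D-count (O+e n) (dominatingO+e n) (Dominating-O+e n)

coeff-D-O⟨2⟩ : ∀ n → coeff (D (O⟨2⟩ n)) ≗ pathCount n true false
coeff-D-O⟨2⟩ n k = trans
  (coeff-D-count (O⟨2⟩ n) (dominatingO⟨2⟩ n) (Dominating-O⟨2⟩ n) k)
  -- Here `m` counts the sets that miss both path vertices. The test rejects all of them, so this
  -- term is 0 and `pathCount` omits it.
  (cong (λ m → m + ↑ (chainCount true true n true false) k + ↑ (outerMember true false) k)
        (count-false (chainOrder n) k))
  where
  outerMember : Family
  outerMember = chainCount true false n ⊞ ↥ (chainCount true true n)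

theorem8 : ((n : ℕ) → 2 ≤ n →
    D (O n) ≈ₚ X *ₚ D (O (n ∸ 1))
    +ₚ (X ^ₚ 2 +ₚ const 2 *ₚ X) *ₚ D (O+e (n ∸ 1))
    +ₚ X ^ₚ 2 *ₚ D (O⟨2⟩ (n ∸ 2)))
    × D (O 1) ≈ₚ X ^ₚ 4 +ₚ const 4 *ₚ X ^ₚ 3 +ₚ const 6 *ₚ X ^ₚ 2
theorem8 = recursion , initial
  where
  recursion : ∀ n → 2 ≤ n →
    D (O n) ≈ₚ X *ₚ D (O (n ∸ 1))
    +ₚ (X ^ₚ 2 +ₚ const 2 *ₚ X) *ₚ D (O+e (n ∸ 1))
    +ₚ X ^ₚ 2 *ₚ D (O⟨2⟩ (n ∸ 2))
  recursion (suc zero)    (s≤s ())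
  recursion (suc (suc n)) _ k = begin
    coeff (D (O (2 + n))) k
      ≡⟨ coeff-D-O (2 + n) k ⟩
    chainCount true false (2 + n) true false k
      ≡⟨ chainCount-recurrence n true false k ⟩
    recurrence n true false k
      ≡⟨ ⊕-cong (⊕-cong first second) third k ⟨
    (coeff P ⊕ coeff Q ⊕ coeff R) k
      ≡⟨ cong (_+ coeff R k) (coeff-+ₚ P Q k) ⟨
    (coeff (P +ₚ Q) ⊕ coeff R) k
      ≡⟨ coeff-+ₚ (P +ₚ Q) R k ⟨
    coeff (P +ₚ Q +ₚ R) k ∎
    where
    open ≡-Reasoning
    P = X *ₚ D (O (suc n))
    Q = (X ^ₚ 2 +ₚ const 2 *ₚ X) *ₚ D (O+e (suc n))
    R = X ^ₚ 2 *ₚ D (O⟨2⟩ n)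

    first : coeff P ≗ ↑ (chainCount true false (suc n) true false)
    first k = trans (coeff-X-*ₚ (D (O (suc n))) k) (↑-cong (coeff-D-O (suc n)) k)

    second : coeff Q ≗ ↑ ((pendantCount (suc n) ⊞ pendantCount (suc n) ⊞ ↥ (pendantCount (suc n))) true false)
    second k = trans (coeff-X²+2X-*ₚ (D (O+e (suc n))) k)
      (↑-cong (⊕-cong (⊕-cong e e) (↑-cong e)) k)
      where e = coeff-D-O+e (suc n)

    third : coeff R ≗ ↑ (↑ (pathCount n true false))
    third k = trans (coeff-X²-*ₚ (D (O⟨2⟩ n)) k) (↑-cong (↑-cong (coeff-D-O⟨2⟩ n)) k)

  closed : Poly
  closed = X ^ₚ 4 +ₚ const 4 *ₚ X ^ₚ 3 +ₚ const 6 *ₚ X ^ₚ 2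

  initial : D (O 1) ≈ₚ closed
  initial k = trans (coeff-D-O 1 k) (small k)
    where
    small : chainCount true false 1 true false ≗ coeff closed
    small 0 = refl
    small 1 = refl
    small 2 = refl
    small 3 = refl
    small 4 = refl
    -- O₁ has four vertices, so both sides vanish beyond degree 4.
    small (suc (suc (suc (suc (suc _))))) = refl
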